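{- For all positive integers $n$ and non-negative integers $k$, $$\det_{0\le i,j\le n-1}\Big(\sum_{l\ge0}\mathcal P^+_{i+j}(k,l)\Big)= \begin{cases} (-1)^{n_1\binom{k+1}2}(xy)^{(k+1)^2\binom{n_1+1}2-n}, & \text{if } n=(k+1)n_1,\\ (-1)^{n_1\binom{k+1}2}(xy)^{(k+1)^2\binom{n_1+1}2}, & \text{if } n=(k+1)n_1+1,\\ 0, & \text{if } n\not\equiv 0,1 \pmod{k+1}. \end{cases}$$ Here $n_1$ denotes a non-negative integer. For $k=0$ (where the first two cases overlap) only the first case applies, i.e. the determinant equals $(xy)^{\binom n2}$.
   Context: Three-step paths consist of up-steps $(1,1)$, level steps $(1,0)$ and down-steps $(1,-1)$. Weights: $w((1,1))=1$, $w((1,0))=x+y$, $w((1,-1))=xy$, and the weight $w(P)$ of a path is the product of the weights of its steps. $\mathcal P_n(k,l)=\sum_P w(P)$ over all three-step paths from $(0,k)$ to $(n,l)$; $\mathcal P^+_n(k,l)$ is the same sum restricted to paths that never run below the $x$-axis. For fixed $n,k$ the sum $\sum_{l\ge0}\mathcal P^+_n(k,l)$ is finite. These are polynomials in the indeterminates $x,y$. -}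

module Defs where

open import Algebra.Bundles using (CommutativeRing)
open import Data.Nat as ℕ using (ℕ; zero; suc)
import Data.Nat.Properties as ℕₚ
open import Data.Integer as ℤ using (ℤ; +_; 0ℤ; 1ℤ; -1ℤ)
import Data.Integer.Properties as ℤₚ
open import Data.Fin using (Fin; zero; suc; toℕ; punchIn)
open import Data.List using (List; []; _∷_; map; concatMap; filter; foldr)
open import Data.List.Properties using (filter-none)
open import Data.List.Relation.Unary.All as All using (All)
open import Data.Empty using (⊥)
open import Data.Product using (_×_; _,_)
open import Data.Vec using (Vec; []; _∷_)
open import Level using (Level)
open import Relation.Binary.PropositionalEquality using (_≡_; sym; cong; subst)
open import Relation.Nullary using (Dec; _×-dec_)

data Step : Set where
  up level down : Step

rise : Step → ℤ
rise up    = 1ℤ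
rise level = 0ℤ
rise down  = -1ℤ

-- A three-step path with n steps is determined by its starting height and its steps.
paths : (n : ℕ) → List (Vec Step n)
paths zero    = [] ∷ []
paths (suc n) = concatMap (λ s → map (s ∷_) (paths n)) (up ∷ level ∷ down ∷ [])

endHeight : ∀ {n} → ℤ → Vec Step n → ℤ
endHeight h []      = h
endHeight h (s ∷ p) = endHeight (h ℤ.+ rise s) p

heights : ∀ {n} → ℤ → Vec Step n → List ℤ
heights h []      = h ∷ []
heights h (s ∷ p) = h ∷ heights (h ℤ.+ rise s) p

NeverBelow : ∀ {n} → ℤ → Vec Step n → Set
NeverBelow h p = All (0ℤ ℤ.≤_) (heights h p)

Counted : (n k l : ℕ) → Vec Step n → Set
Counted n k l p = endHeight (+ k) p ≡ + l × NeverBelow (+ k) p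

counted? : (n k l : ℕ) (p : Vec Step n) → Dec (Counted n k l p)
counted? n k l p =
  (endHeight (+ k) p ℤ.≟ + l) ×-dec All.all? (0ℤ ℤ.≤?_) (heights (+ k) p)

rise≤1 : ∀ s → rise s ℤ.≤ 1ℤ
rise≤1 up    = ℤₚ.≤-refl
rise≤1 level = ℤ.+≤+ ℕ.z≤n
rise≤1 down  = ℤ.-≤+

endHeight≤ : ∀ {n} h (p : Vec Step n) → endHeight h p ℤ.≤ h ℤ.+ + n
endHeight≤ h [] = ℤₚ.≤-reflexive (sym (ℤₚ.+-identityʳ h))
endHeight≤ {suc n} h (s ∷ p) = begin
  endHeight (h ℤ.+ rise s) p  ≤⟨ endHeight≤ (h ℤ.+ rise s) p ⟩
  (h ℤ.+ rise s) ℤ.+ + n      ≤⟨ ℤₚ.+-monoˡ-≤ (+ n) (ℤₚ.+-monoʳ-≤ h (rise≤1 s)) ⟩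
  (h ℤ.+ 1ℤ) ℤ.+ + n          ≡⟨ ℤₚ.+-assoc h 1ℤ (+ n) ⟩
  h ℤ.+ + suc n               ∎
  where open ℤₚ.≤-Reasoning

module Determinant {c ℓ : Level} (R : CommutativeRing c ℓ) where
  open CommutativeRing R using (Carrier; _+_; _*_; -_; 0#; 1#; semiring)
  open import Algebra.Properties.Semiring.Exp semiring using (_^_)
  open import Algebra.Properties.Semiring.Sum semiring using (sum)

  -- Laplace expansion along the first row.
  det : ∀ n → (Fin n → Fin n → Carrier) → Carrier
  det zero    M = 1#
  det (suc n) M =
    sum (λ j → (- 1#) ^ toℕ j * M zero j * det n (λ r s → M (suc r) (punchIn j s)))

module ThreeStepPaths {c ℓ : Level} (R : CommutativeRing c ℓ)
                      (x y : CommutativeRing.Carrier R) where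
  open CommutativeRing R using (Carrier; _+_; _*_; -_; 0#; 1#; semiring)
  open import Algebra.Properties.Semiring.Sum semiring using (sum)

  stepWeight : Step → Carrier
  stepWeight up    = 1#
  stepWeight level = x + y
  stepWeight down  = x * y

  weight : ∀ {n} → Vec Step n → Carrier
  weight []      = 1#
  weight (s ∷ p) = stepWeight s * weight p

  𝒫⁺ : (n k l : ℕ) → Carrier
  𝒫⁺ n k l = foldr _+_ 0# (map weight (filter (counted? n k l) (paths n)))

  -- The sum over all l ≥ 0: by 𝒫⁺-vanishes, the terms with l > k + n are zero.
  Σ𝒫⁺ : (n k : ℕ) → Carrier
  Σ𝒫⁺ n k = sum {suc (k ℕ.+ n)} (λ l → 𝒫⁺ n k (toℕ l))

  𝒫⁺-vanishes : ∀ n k l → k ℕ.+ n ℕ.< l → 𝒫⁺ n k l ≡ 0#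
  𝒫⁺-vanishes n k l k+n<l =
    cong (λ ps → foldr _+_ 0# (map weight ps))
         (filter-none (counted? n k l) (All.universal notCounted (paths n)))
    where
    notCounted : ∀ p → Counted n k l p → ⊥
    notCounted p (e , _) = ℕₚ.<⇒≱ k+n<l
      (ℤₚ.drop‿+≤+ (subst (ℤ._≤ + (k ℕ.+ n)) e (endHeight≤ (+ k) p)))

{-# OPTIONS --safe #-}

-- Put s = x + y, q = xy, m = k + 1.  The entry (i , j) is E m (i + j), where E h is the moment
-- sequence of the paths that start at height h - 1; the columns are thus the iterated shifts of
-- E m, and shift (E h) = E (h + 1) + s E h + q E (h - 1).  Unitriangular column operations replace
-- them by monic polynomials in the shift applied to E m.  A suitable choice gives, in position
-- b + a m with 0 ≤ b < m and K = (a + 1) m, the column E K if b = 0 and E (K + b) + q^b E (K - b)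
-- otherwise.  On the n rows of the determinant, E h = E n for h ≥ n, because a path with fewer
-- than h steps cannot run below the axis.  Hence, from the last block to the first, every
-- E (K + b) repeats another column and can be dropped; what is left is E 1, …, E n with each
-- block of m columns reversed, times powers of q.  If n ≡ r (mod m) with 2 ≤ r < m, the columns
-- r - 1 and r from the right are both multiples of E n.

module Submission where

open import Defs
open import Algebra.Bundles using (CommutativeRing)
open import Algebra.Properties.Semiring.Exp using ()
open import Data.Fin using (Fin; zero; suc; toℕ; punchIn)
open import Data.Integer as ℤ using (ℤ; +_; 0ℤ; -1ℤ)
open import Data.List using (List; []; _∷_; [_]; _++_; _ʳ++_; length; tabulate; map; filter; foldr)
open import Data.List.Membership.Propositional using (_∈_)
open import Data.List.Membership.Propositional.Properties using (∈-∃++; ∈-++⁺ʳ)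
open import Data.List.Properties
  using (++-assoc; ++-identityʳ; tabulate-cong; filter-none; filter-accept; filter-reject)
open import Data.List.Relation.Unary.All as All using ([]; _∷_)
open import Data.List.Relation.Unary.Any using (here; there)
open import Data.Nat as ℕ using (ℕ; zero; suc; z≤n; s≤s)
open import Data.Nat.Combinatorics using (_C_; nC1≡n; nCk+nC[k+1]≡[n+1]C[k+1])
open import Data.Nat.Divisibility using (n∣m*n)
open import Data.Nat.DivMod using (_/_; _%_; m<n⇒m%n≡m; [m+kn]%n≡m%n; m≡m%n+[m/n]*n; m%n<n;
  +-distrib-/-∣ʳ; m<n⇒m/n≡0; m*n/n≡m)
import Data.Nat.Properties as ℕₚ
open import Data.Nat.Tactic.RingSolver using (solve-∀)
open import Data.Product using (_×_; _,_; ∃)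
open import Data.Sum using (_⊎_; inj₁; inj₂)
open import Data.Vec using (Vec; []; _∷_)
open import Function using (_∘_)
open import Function.Bundles using (_⇔_; mk⇔; Equivalence)
open import Level using (_⊔_)
open import Relation.Binary.PropositionalEquality as ≡ using (_≡_; _≢_)
open import Relation.Nullary using (¬_; yes; no; _×-dec_; contradiction)
open import Relation.Unary using (Decidable)

-- Determinants of lists of columns: multilinearity, alternation, agreement with `det`.

module ColumnDeterminant {c ℓ} (R : CommutativeRing c ℓ) where
  open CommutativeRing R hiding (zero)
  open Determinant R using (det)
  open import Algebra.Properties.Semiring.Exp semiring
  open import Algebra.Properties.Semiring.Sum semiring
  open import Algebra.Properties.Ring ring using (-1*x≈-x)
  open import Algebra.Solver.Ring.NaturalCoefficients.Default commutativeSemiring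
    using (solve; _:=_; _:+_; _:*_; con)
  open import Relation.Binary.Reasoning.Setoid setoid

  Column : Set c
  Column = ℕ → Carrier

  -- The semiring solver treats `- 1#` as an atom, so the cancellation of opposite terms is supplied
  -- separately.
  neg-cancel : ∀ z → z + (- 1#) * z ≈ 0#
  neg-cancel z = trans (+-congˡ (-1*x≈-x z)) (-‿inverseʳ z)

  -- The determinant of the rows r, …, r + n - 1 of a list of n columns; it is 0 for a list of any
  -- other length, so that the laws below need no length hypothesis.  In the Laplace expansion
  -- along row r the columns to the left of the current one are kept in reverse order.
  colDet : ℕ → ℕ → List Column → Carrier
  expand : ℕ → ℕ → List Column → List Column → Carrier
  colDet zero    r []      = 1#
  colDet zero    r (_ ∷ _) = 0#
  colDet (suc n) r vs      = expand n r [] vs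
  expand n r pre []         = 0#
  expand n r pre (v ∷ post) =
    v r * colDet n (suc r) (pre ʳ++ post) + (- 1#) * expand n r (v ∷ pre) post

  module _ (a b : Carrier) where

    -- The linear relation is demanded only on the rows that `colDet n r` reads, because the
    -- coincidences between columns used later hold only on finitely many rows.
    data Combination (n r : ℕ) : (ws us vs : List Column) → Set (c ⊔ ℓ) where
      here  : ∀ {w u v vs} → (∀ i → r ℕ.≤ i → i ℕ.< r ℕ.+ n → w i ≈ a * u i + b * v i) →
              Combination n r (w ∷ vs) (u ∷ vs) (v ∷ vs)
      there : ∀ {x ws us vs} → Combination n r ws us vs →
              Combination n r (x ∷ ws) (x ∷ us) (x ∷ vs)

    combination-ʳ++ : ∀ {n r ws us vs} pre → Combination n r ws us vs →
      Combination n r (pre ʳ++ ws) (pre ʳ++ us) (pre ʳ++ vs)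
    combination-ʳ++ []        p = p
    combination-ʳ++ (x ∷ pre) p = combination-ʳ++ pre (there p)

    combination-++ʳ : ∀ {n r ws us vs} → Combination n r ws us vs → ∀ post →
      Combination n r (ws ʳ++ post) (us ʳ++ post) (vs ʳ++ post)
    combination-++ʳ (here {vs = vs} e) post = combination-ʳ++ vs (here e)
    combination-++ʳ (there {x} p)      post = combination-++ʳ p (x ∷ post)

    combination-suc : ∀ {n r ws us vs} → Combination (suc n) r ws us vs →
      Combination n (suc r) ws us vs
    combination-suc {n} {r} (here e) =
      here (λ i r<i i< → e i (ℕₚ.<⇒≤ r<i) (≡.subst (i ℕ.<_) (≡.sym (ℕₚ.+-suc r n)) i<))
    combination-suc (there p) = there (combination-suc p)

    -- Mutual induction: during the expansion the changed column has either been passed already, and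
    -- then lies in every minor (`expand-linearˡ`), or is still ahead (`expand-linearʳ`).
    colDet-linear : ∀ n r {ws us vs} → Combination n r ws us vs →
      colDet n r ws ≈ a * colDet n r us + b * colDet n r vs

    expand-linearˡ : ∀ n r {ws us vs} → Combination n (suc r) ws us vs → ∀ post →
      expand n r ws post ≈ a * expand n r us post + b * expand n r vs post
    expand-linearˡ n r p [] = solve 2 (λ a b → con 0 := a :* con 0 :+ b :* con 0) refl a b
    expand-linearˡ n r p (x ∷ post) = begin
      _ ≈⟨ +-cong (*-congˡ (colDet-linear n (suc r) (combination-++ʳ p post)))
                  (*-congˡ (expand-linearˡ n r (there p) post)) ⟩
      _ ≈⟨ solve 8 (λ a b x e u v u′ v′ →
             x :* (a :* u :+ b :* v) :+ e :* (a :* u′ :+ b :* v′) :=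
             a :* (x :* u :+ e :* u′) :+ b :* (x :* v :+ e :* v′))
             refl a b (x r) (- 1#) _ _ _ _ ⟩
      _ ∎

    expand-linearʳ : ∀ n r pre {ws us vs} → Combination (suc n) r ws us vs →
      expand n r pre ws ≈ a * expand n r pre us + b * expand n r pre vs
    expand-linearʳ n r pre (here {w} {u} {v} {vs} e) = begin
      _ ≈⟨ +-cong (*-congʳ (e r ℕₚ.≤-refl (ℕₚ.m<m+n r (s≤s z≤n))))
                  (*-congˡ (expand-linearˡ n r {w ∷ pre} {u ∷ pre} {v ∷ pre}
                     (combination-suc (here e)) vs)) ⟩
      _ ≈⟨ solve 8 (λ a b u v e d u′ v′ →
             (a :* u :+ b :* v) :* d :+ e :* (a :* u′ :+ b :* v′) :=
             a :* (u :* d :+ e :* u′) :+ b :* (v :* d :+ e :* v′))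
             refl a b (u r) (v r) (- 1#) _ _ _ ⟩
      _ ∎
    expand-linearʳ n r pre (there {x} p) = begin
      _ ≈⟨ +-cong (*-congˡ (colDet-linear n (suc r) (combination-ʳ++ pre (combination-suc p))))
                  (*-congˡ (expand-linearʳ n r (x ∷ pre) p)) ⟩
      _ ≈⟨ solve 8 (λ a b x e u v u′ v′ →
             x :* (a :* u :+ b :* v) :+ e :* (a :* u′ :+ b :* v′) :=
             a :* (x :* u :+ e :* u′) :+ b :* (x :* v :+ e :* v′))
             refl a b (x r) (- 1#) _ _ _ _ ⟩
      _ ∎

    colDet-linear zero    r (here _)  = solve 2 (λ a b → con 0 := a :* con 0 :+ b :* con 0) refl a b
    colDet-linear zero    r (there _) = solve 2 (λ a b → con 0 := a :* con 0 :+ b :* con 0) refl a b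
    colDet-linear (suc n) r p         = expand-linearʳ n r [] p

  data Adjacent : List Column → Set c where
    here  : ∀ {u vs} → Adjacent (u ∷ u ∷ vs)
    there : ∀ {x vs} → Adjacent vs → Adjacent (x ∷ vs)

  adjacent-ʳ++ : ∀ {vs} pre → Adjacent vs → Adjacent (pre ʳ++ vs)
  adjacent-ʳ++ []        p = p
  adjacent-ʳ++ (x ∷ pre) p = adjacent-ʳ++ pre (there p)

  adjacent-++ʳ : ∀ {vs} → Adjacent vs → ∀ post → Adjacent (vs ʳ++ post)
  adjacent-++ʳ (here {vs = vs}) post = adjacent-ʳ++ vs here
  adjacent-++ʳ (there {x} p)    post = adjacent-++ʳ p (x ∷ post)

  -- Valid in every characteristic: the two equal neighbours have equal minors and opposite signs,
  -- and every other minor still contains the pair. Distant repetitions are reduced to this case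
  -- later.
  colDet-alternating : ∀ n r {vs} → Adjacent vs → colDet n r vs ≈ 0#

  expand-alternatingˡ : ∀ n r {pre} → Adjacent pre → ∀ post → expand n r pre post ≈ 0#
  expand-alternatingˡ n r p [] = refl
  expand-alternatingˡ n r p (x ∷ post) = begin
    _ ≈⟨ +-cong (*-congˡ (colDet-alternating n (suc r) (adjacent-++ʳ p post)))
                (*-congˡ (expand-alternatingˡ n r (there p) post)) ⟩
    _ ≈⟨ solve 2 (λ x e → x :* con 0 :+ e :* con 0 := con 0) refl (x r) (- 1#) ⟩
    _ ∎

  expand-alternatingʳ : ∀ n r pre {vs} → Adjacent vs → expand n r pre vs ≈ 0#
  expand-alternatingʳ n r pre (here {u} {vs}) = begin
    -- Both copies of `u` leave the same minor, since `(u ∷ pre) ʳ++ vs` reduces to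
    -- `pre ʳ++ (u ∷ vs)`.
    _ ≈⟨ +-congˡ (*-congˡ (+-congˡ (*-congˡ
           (expand-alternatingˡ n r {u ∷ u ∷ pre} here vs)))) ⟩
    _ ≈⟨ solve 2 (λ x e → x :+ e :* (x :+ e :* con 0) := x :+ e :* x) refl _ (- 1#) ⟩
    _ ≈⟨ neg-cancel _ ⟩
    _ ∎
  expand-alternatingʳ n r pre (there {x} p) = begin
    _ ≈⟨ +-cong (*-congˡ (colDet-alternating n (suc r) (adjacent-ʳ++ pre p)))
                (*-congˡ (expand-alternatingʳ n r (x ∷ pre) p)) ⟩
    _ ≈⟨ solve 2 (λ x e → x :* con 0 :+ e :* con 0 := con 0) refl (x r) (- 1#) ⟩
    _ ∎

  colDet-alternating zero    r here      = refl
  colDet-alternating zero    r (there _) = refl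
  colDet-alternating (suc n) r p         = expand-alternatingʳ n r [] p

  -- Carrying the passed columns `pre` along makes the induction work: deleting a later column keeps
  -- `d zero`, which joins `pre`, and one factor `- 1#` comes out of the remaining sum.
  expand-tabulate : ∀ n r {m} pre (d : Fin (suc m) → Column) →
    sum (λ j → (- 1#) ^ toℕ j * d j r * colDet n (suc r) (pre ʳ++ tabulate (d ∘ punchIn j)))
      ≈ expand n r pre (tabulate d)
  expand-tabulate n r {zero} pre d = +-cong (*-congʳ (*-identityˡ _)) (sym (zeroʳ _))
  expand-tabulate n r {suc m} pre d = +-cong (*-congʳ (*-identityˡ _)) (begin
    sum (λ j → (- 1#) ^ suc (toℕ j) * d (suc j) r * A j)
      ≈⟨ sum-cong-≋ {suc m} (λ j → trans (*-congʳ (*-assoc (- 1#) ((- 1#) ^ toℕ j) (d (suc j) r)))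
                                        (*-assoc (- 1#) _ (A j))) ⟩
    sum (λ j → (- 1#) * ((- 1#) ^ toℕ j * d (suc j) r * A j))
      ≈⟨ sym (*-distribˡ-sum (- 1#) (λ j → (- 1#) ^ toℕ j * d (suc j) r * A j)) ⟩
    (- 1#) * sum (λ j → (- 1#) ^ toℕ j * d (suc j) r * A j)
      ≈⟨ *-congˡ (expand-tabulate n r (d zero ∷ pre) (d ∘ suc)) ⟩
    (- 1#) * expand n r (d zero ∷ pre) (tabulate (d ∘ suc)) ∎)
    where
    A : Fin (suc m) → Carrier
    A j = colDet n (suc r) (pre ʳ++ tabulate (d ∘ punchIn (suc j)))

  det≈colDet : ∀ n r {M : Fin n → Fin n → Carrier} (d : Fin n → Column) →
    (∀ i j → M i j ≈ d j (r ℕ.+ toℕ i)) → det n M ≈ colDet n r (tabulate d)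
  det≈colDet zero    r d M≈d = refl
  det≈colDet (suc n) r d M≈d = trans
    (sum-cong-≋ {suc n} (λ j → *-cong
      (*-congˡ {(- 1#) ^ toℕ j} (trans (M≈d zero j) (reflexive (≡.cong (d j) (ℕₚ.+-identityʳ r)))))
      (det≈colDet n (suc r) (d ∘ punchIn j) (λ i s →
        trans (M≈d (suc i) _) (reflexive (≡.cong (d (punchIn j s)) (ℕₚ.+-suc r (toℕ i))))))))
    (expand-tabulate n r [] d)

-- Consecutive terms of a sequence as lists.

module _ {a} {A : Set a} where

  segment : (ℕ → A) → ℕ → ℕ → List A
  segment f i zero    = []
  segment f i (suc m) = f i ∷ segment f (suc i) m

  length-segment : ∀ f i m → length (segment f i m) ≡ m
  length-segment f i zero    = ≡.refl
  length-segment f i (suc m) = ≡.cong suc (length-segment f (suc i) m)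

  segment-++ : ∀ f i m m′ → segment f i m ++ segment f (m ℕ.+ i) m′ ≡ segment f i (m ℕ.+ m′)
  segment-++ f i zero    m′ = ≡.refl
  segment-++ f i (suc m) m′ = ≡.cong (f i ∷_) (≡.trans
    (≡.cong (λ j → segment f (suc i) m ++ segment f j m′) (≡.sym (ℕₚ.+-suc m i)))
    (segment-++ f (suc i) m m′))

  segment-cong : ∀ {f g : ℕ → A} i j m → (∀ t → t ℕ.< m → f (t ℕ.+ i) ≡ g (t ℕ.+ j)) →
    segment f i m ≡ segment g j m
  segment-cong i j zero    e = ≡.refl
  segment-cong {f} {g} i j (suc m) e = ≡.cong₂ _∷_ (e 0 (s≤s z≤n))
    (segment-cong (suc i) (suc j) m (λ t t<m →
      ≡.trans (≡.cong f (ℕₚ.+-suc t i)) (≡.trans (e (suc t) (s≤s t<m)) (≡.cong g (≡.sym (ℕₚ.+-suc t j))))))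

  segment-∈ : ∀ f i m h → i ℕ.≤ h → h ℕ.< m ℕ.+ i → f h ∈ segment f i m
  segment-∈ f i zero    h i≤h h<i = contradiction h<i (ℕₚ.≤⇒≯ i≤h)
  segment-∈ f i (suc m) h i≤h h< with ℕₚ.m≤n⇒m<n∨m≡n i≤h
  ... | inj₁ i<h    = there (segment-∈ f (suc i) m h i<h (≡.subst (h ℕ.<_) (≡.sym (ℕₚ.+-suc m i)) h<))
  ... | inj₂ ≡.refl = here ≡.refl

  tabulate-segment : ∀ f i m → tabulate {n = m} (λ j → f (toℕ j ℕ.+ i)) ≡ segment f i m
  tabulate-segment f i zero    = ≡.refl
  tabulate-segment f i (suc m) = ≡.cong (f i ∷_) (≡.trans
    (tabulate-cong (λ j → ≡.cong f (≡.sym (ℕₚ.+-suc (toℕ j) i))))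
    (tabulate-segment f (suc i) m))

-- Column operations on a determinant with rows 0, ..., n - 1.

module ColumnOperations {c ℓ} (R : CommutativeRing c ℓ) (n : ℕ) where
  open CommutativeRing R hiding (zero)
  open ColumnDeterminant R
  open import Algebra.Properties.Semiring.Exp semiring
  open import Algebra.Properties.Ring ring using (-1*x≈-x; +-inverseˡ-unique)
  open import Algebra.Solver.Ring.NaturalCoefficients.Default commutativeSemiring
    using (solve; _:=_; _:+_; _:*_; con)
  open import Relation.Binary.Reasoning.Setoid setoid

  D : List Column → Carrier
  D = colDet n 0

  infix 4 _≋_
  _≋_ : Column → Column → Set ℓ
  u ≋ v = ∀ i → i ℕ.< n → u i ≈ v i

  ≋-refl : ∀ {u} → u ≋ u
  ≋-refl i _ = refl

  infix 6 _⊕_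
  _⊕_ : Column → Column → Column
  (u ⊕ v) i = u i + v i

  infix 7 _⊙_
  _⊙_ : Carrier → Column → Column
  (a ⊙ u) i = a * u i

  D-≡ : ∀ {us vs} → us ≡ vs → D us ≈ D vs
  D-≡ e = reflexive (≡.cong D e)

  D-linear : ∀ xs {ys w} a u b v → w ≋ a ⊙ u ⊕ b ⊙ v →
    D (xs ++ w ∷ ys) ≈ a * D (xs ++ u ∷ ys) + b * D (xs ++ v ∷ ys)
  D-linear xs {ys} {w} a u b v e = colDet-linear a b n 0 (at xs)
    where
    at : ∀ xs → Combination a b n 0 (xs ++ w ∷ ys) (xs ++ u ∷ ys) (xs ++ v ∷ ys)
    at []       = here (λ i _ → e i)
    at (x ∷ xs) = there (at xs)

  D-adjacent : ∀ xs {u ys} → D (xs ++ u ∷ u ∷ ys) ≈ 0#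
  D-adjacent xs {u} {ys} = colDet-alternating n 0 (at xs)
    where
    at : ∀ xs → Adjacent (xs ++ u ∷ u ∷ ys)
    at []       = here
    at (x ∷ xs) = there (at xs)

  D-cong : ∀ xs {ys u v} → u ≋ v → D (xs ++ u ∷ ys) ≈ D (xs ++ v ∷ ys)
  D-cong xs {v = v} u≋v = trans
    (D-linear xs 1# v 0# v (λ i i<n → trans (u≋v i i<n)
      (solve 1 (λ x → x := con 1 :* x :+ con 0 :* x) refl (v i))))
    (solve 1 (λ x → con 1 :* x :+ con 0 :* x := x) refl _)

  -- Polarisation: the determinant with `w` = u + v in both places vanishes, and its expansion
  -- leaves only the two mixed terms.
  D-swap : ∀ xs u v {ys} → D (xs ++ u ∷ v ∷ ys) ≈ (- 1#) * D (xs ++ v ∷ u ∷ ys)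
  D-swap xs u v {ys} = trans (+-inverseˡ-unique _ _ sum≈0) (sym (-1*x≈-x _))
    where
    w : Column
    w = 1# ⊙ u ⊕ 1# ⊙ v
    inner : ∀ z → D (xs ++ z ∷ w ∷ ys) ≈ D (xs ++ z ∷ u ∷ ys) + D (xs ++ z ∷ v ∷ ys)
    inner z = begin
      D (xs ++ z ∷ w ∷ ys)                ≈⟨ D-≡ (≡.sym (++-assoc xs [ z ] _)) ⟩
      D ((xs ++ [ z ]) ++ w ∷ ys)         ≈⟨ D-linear (xs ++ [ z ]) 1# u 1# v ≋-refl ⟩
      _                                   ≈⟨ +-cong (*-identityˡ _) (*-identityˡ _) ⟩
      D ((xs ++ [ z ]) ++ u ∷ ys) + D ((xs ++ [ z ]) ++ v ∷ ys)
        ≈⟨ +-cong (D-≡ (++-assoc xs [ z ] _)) (D-≡ (++-assoc xs [ z ] _)) ⟩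
      _                                   ∎
    sum≈0 : D (xs ++ u ∷ v ∷ ys) + D (xs ++ v ∷ u ∷ ys) ≈ 0#
    sum≈0 = begin
      _  ≈⟨ sym (+-cong (trans (+-congʳ (D-adjacent xs)) (+-identityˡ _))
                        (trans (+-congˡ (D-adjacent xs)) (+-identityʳ _))) ⟩
      _  ≈⟨ sym (+-cong (inner u) (inner v)) ⟩
      _  ≈⟨ sym (+-cong (*-identityˡ _) (*-identityˡ _)) ⟩
      _  ≈⟨ sym (D-linear xs 1# u 1# v ≋-refl) ⟩
      _  ≈⟨ D-adjacent xs ⟩
      0# ∎

  D-move : ∀ xs us v {ys} →
    D (xs ++ us ++ v ∷ ys) ≈ (- 1#) ^ length us * D (xs ++ v ∷ us ++ ys)
  D-move xs []       v      = sym (*-identityˡ _)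
  D-move xs (u ∷ us) v {ys} = begin
    D (xs ++ u ∷ us ++ v ∷ ys)          ≈⟨ D-≡ (≡.sym (++-assoc xs [ u ] _)) ⟩
    D ((xs ++ [ u ]) ++ us ++ v ∷ ys)   ≈⟨ D-move (xs ++ [ u ]) us v ⟩
    s * D ((xs ++ [ u ]) ++ v ∷ us ++ ys) ≈⟨ *-congˡ (D-≡ (++-assoc xs [ u ] _)) ⟩
    s * D (xs ++ u ∷ v ∷ us ++ ys)      ≈⟨ *-congˡ (D-swap xs u v) ⟩
    s * ((- 1#) * _)                    ≈⟨ sym (*-assoc _ _ _) ⟩
    (s * (- 1#)) * _                    ≈⟨ *-congʳ (*-comm _ _) ⟩
    ((- 1#) * s) * _                    ∎
    where s = (- 1#) ^ length us

  -- Equal columns at a distance are made adjacent by `D-move`, at the cost of a sign.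
  D-repeatʳ : ∀ xs {u ys} → u ∈ ys → D (xs ++ u ∷ ys) ≈ 0#
  D-repeatʳ xs {u} u∈ys with us , zs , ≡.refl ← ∈-∃++ u∈ys = begin
    D (xs ++ u ∷ us ++ u ∷ zs)             ≈⟨ D-≡ (≡.sym (++-assoc xs [ u ] _)) ⟩
    D ((xs ++ [ u ]) ++ us ++ u ∷ zs)      ≈⟨ D-move (xs ++ [ u ]) us u ⟩
    _ * D ((xs ++ [ u ]) ++ u ∷ us ++ zs)  ≈⟨ *-congˡ (D-≡ (++-assoc xs [ u ] _)) ⟩
    _ * D (xs ++ u ∷ u ∷ us ++ zs)         ≈⟨ *-congˡ (D-adjacent xs) ⟩
    _ * 0#                                 ≈⟨ zeroʳ _ ⟩
    0#                                     ∎

  D-repeatˡ : ∀ {xs u} ys → u ∈ xs → D (xs ++ u ∷ ys) ≈ 0#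
  D-repeatˡ {u = u} ys u∈xs with as , bs , ≡.refl ← ∈-∃++ u∈xs = begin
    D ((as ++ u ∷ bs) ++ u ∷ ys)  ≈⟨ D-≡ (++-assoc as (u ∷ bs) _) ⟩
    D (as ++ u ∷ bs ++ u ∷ ys)    ≈⟨ D-repeatʳ as (∈-++⁺ʳ bs (here ≡.refl)) ⟩
    0#                            ∎

  D-absorb : ∀ xs {ys w} a u b v → w ≋ a ⊙ u ⊕ b ⊙ v → v ∈ xs ⊎ v ∈ ys →
    D (xs ++ w ∷ ys) ≈ a * D (xs ++ u ∷ ys)
  D-absorb xs {ys} a u b v e v∈ = begin
    _                           ≈⟨ D-linear xs a u b v e ⟩
    a * _ + b * D (xs ++ v ∷ ys)  ≈⟨ +-congˡ (*-congˡ (vanish v∈)) ⟩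
    a * _ + b * 0#              ≈⟨ trans (+-congˡ (zeroʳ b)) (+-identityʳ _) ⟩
    _                           ∎
    where
    vanish : v ∈ xs ⊎ v ∈ ys → D (xs ++ v ∷ ys) ≈ 0#
    vanish (inj₁ v∈xs) = D-repeatˡ ys v∈xs
    vanish (inj₂ v∈ys) = D-repeatʳ xs v∈ys

  -- ModSpan φ j u w: the column w - u lies in the span of φ 0, …, φ (j - 1).
  data ModSpan (φ : ℕ → Column) (j : ℕ) (u : Column) : Column → Set (c ⊔ ℓ) where
    base : ∀ {w} → (∀ t → w t ≈ u t) → ModSpan φ j u w
    add  : ∀ {w w′} a i → i ℕ.< j → (∀ t → w t ≈ a * φ i t + w′ t) →
           ModSpan φ j u w′ → ModSpan φ j u w

  modSpan-resp : ∀ {φ j u v w} → (∀ t → w t ≈ v t) → ModSpan φ j u v → ModSpan φ j u w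
  modSpan-resp e (base f)        = base (λ t → trans (e t) (f t))
  modSpan-resp e (add a i i<j f p) = add a i i<j (λ t → trans (e t) (f t)) p

  D-modSpan : ∀ {φ j u w ys} → ModSpan φ j u w →
    D (segment φ 0 j ++ w ∷ ys) ≈ D (segment φ 0 j ++ u ∷ ys)
  D-modSpan {φ} {j} (base e) = D-cong (segment φ 0 j) (λ i _ → e i)
  D-modSpan {φ} {j} (add {w′ = w′} a i i<j e p) = begin
    _ ≈⟨ D-absorb (segment φ 0 j) 1# w′ a (φ i)
           (λ t _ → trans (e t) (trans (+-comm _ _) (+-congʳ (sym (*-identityˡ _)))))
           (inj₁ (segment-∈ φ 0 j i z≤n (≡.subst (i ℕ.<_) (≡.sym (ℕₚ.+-identityʳ j)) i<j))) ⟩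
    _ ≈⟨ *-identityˡ _ ⟩
    _ ≈⟨ D-modSpan p ⟩
    _ ∎

  -- Columns are replaced from left to right: when `ψ j` is reached, everything to its left is
  -- already φ 0, ..., φ (j - 1), so its correction terms repeat existing columns.
  D-unitriangular : ∀ (φ ψ : ℕ → Column) → (∀ j → ModSpan φ j (φ j) (ψ j)) →
    ∀ m → D (segment ψ 0 m) ≈ D (segment φ 0 m)
  D-unitriangular φ ψ ψ≈φ = go 0
    where
    go : ∀ j m → D (segment φ 0 j ++ segment ψ j m) ≈ D (segment φ 0 (j ℕ.+ m))
    go j zero    = D-≡ (≡.trans (++-identityʳ _) (≡.cong (segment φ 0) (≡.sym (ℕₚ.+-identityʳ j))))
    go j (suc m) = begin
      D (segment φ 0 j ++ ψ j ∷ segment ψ (suc j) m)   ≈⟨ D-modSpan (ψ≈φ j) ⟩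
      D (segment φ 0 j ++ φ j ∷ segment ψ (suc j) m)   ≈⟨ D-≡ (snoc j) ⟩
      D (segment φ 0 (suc j) ++ segment ψ (suc j) m)   ≈⟨ go (suc j) m ⟩
      D (segment φ 0 (suc j ℕ.+ m))                    ≈⟨ D-≡ (≡.cong (segment φ 0) (≡.sym (ℕₚ.+-suc j m))) ⟩
      D (segment φ 0 (j ℕ.+ suc m))                    ∎
      where
      snoc : ∀ j {ys} → segment φ 0 j ++ φ j ∷ ys ≡ segment φ 0 (suc j) ++ ys
      snoc j {ys} = ≡.trans (≡.sym (++-assoc (segment φ 0 j) [ φ j ] ys)) (≡.cong (_++ ys)
        (≡.trans (≡.cong (λ i → segment φ 0 j ++ [ φ i ]) (≡.sym (ℕₚ.+-identityʳ j)))
        (≡.trans (segment-++ φ 0 j 1) (≡.cong (segment φ 0) (ℕₚ.+-comm j 1)))))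

  shift : Column → Column
  shift u i = u (suc i)

  modSpan-add : ∀ {φ j u w i z} a → i ℕ.< j → ModSpan φ i (φ i) z → ModSpan φ j u w →
    ModSpan φ j u (a ⊙ z ⊕ w)
  modSpan-add {φ} {j} {u} {w} {i} a i<j q p = go q
    where
    go : ∀ {z} → ModSpan φ i (φ i) z → ModSpan φ j u (a ⊙ z ⊕ w)
    go (base e) = add a i i<j (λ t → +-congʳ (*-congˡ (e t))) p
    go (add {w′ = w′} b i′ i′<i e q) = add (a * b) i′ (ℕₚ.<-trans i′<i i<j)
      (λ t → trans (+-congʳ (*-congˡ (e t)))
        (solve 5 (λ a b f z w → a :* (b :* f :+ z) :+ w := (a :* b) :* f :+ (a :* z :+ w))
          refl a b (φ i′ t) (w′ t) (w t)))
      (go q)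

  -- The `ψ j` are the iterated shifts of `φ 0`. The shift is linear and sends `φ j` to `φ (suc j)`
  -- modulo earlier columns, so by induction `ψ j` is `φ j` modulo earlier columns.
  D-krylov : ∀ (φ ψ : ℕ → Column) → (∀ t → ψ 0 t ≈ φ 0 t) →
    (∀ j t → ψ (suc j) t ≈ ψ j (suc t)) →
    (∀ j → ModSpan φ (suc j) (φ (suc j)) (shift (φ j))) →
    ∀ m → D (segment ψ 0 m) ≈ D (segment φ 0 m)
  D-krylov φ ψ ψ0 ψsuc φsuc = D-unitriangular φ ψ congruent
    where
    shifted : ∀ j {w} → ModSpan φ j (φ j) w → ModSpan φ (suc j) (φ (suc j)) (shift w)
    shifted j (base e) = modSpan-resp (λ t → e (suc t)) (φsuc j)
    shifted j (add {w′ = w′} a i i<j e p) = modSpan-resp (λ t → e (suc t))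
      (modSpan-add a (s≤s i<j) (φsuc i) (shifted j p))
    congruent : ∀ j → ModSpan φ j (φ j) (ψ j)
    congruent zero    = base ψ0
    congruent (suc j) = modSpan-resp (ψsuc j) (shifted j (congruent j))

-- Sums of consecutive integers as binomial coefficients.

rangeSum : ℕ → ℕ → ℕ
rangeSum b zero    = 0
rangeSum b (suc r) = b ℕ.+ rangeSum (suc b) r

[1+n]C2≡n+nC2 : ∀ n → suc n C 2 ≡ n ℕ.+ n C 2
[1+n]C2≡n+nC2 n = ≡.trans (≡.sym (nCk+nC[k+1]≡[n+1]C[k+1] n 1)) (≡.cong (ℕ._+ n C 2) (nC1≡n n))

bC2+rangeSum≡[r+b]C2 : ∀ b r → b C 2 ℕ.+ rangeSum b r ≡ (r ℕ.+ b) C 2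
bC2+rangeSum≡[r+b]C2 b zero    = ℕₚ.+-identityʳ _
bC2+rangeSum≡[r+b]C2 b (suc r) = begin
  b C 2 ℕ.+ (b ℕ.+ rangeSum (suc b) r)  ≡⟨ ≡.sym (ℕₚ.+-assoc (b C 2) b _) ⟩
  (b C 2 ℕ.+ b) ℕ.+ rangeSum (suc b) r  ≡⟨ ≡.cong (ℕ._+ rangeSum (suc b) r)
                                             (≡.trans (ℕₚ.+-comm (b C 2) b) (≡.sym ([1+n]C2≡n+nC2 b))) ⟩
  suc b C 2 ℕ.+ rangeSum (suc b) r      ≡⟨ bC2+rangeSum≡[r+b]C2 (suc b) r ⟩
  (r ℕ.+ suc b) C 2                     ≡⟨ ≡.cong (_C 2) (ℕₚ.+-suc r b) ⟩
  (suc r ℕ.+ b) C 2                     ∎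
  where open ≡.≡-Reasoning

-- The moment columns `E`, their differences, and the determinant of E 1, ..., E n.

module HeightColumns {c ℓ} (R : CommutativeRing c ℓ) (s q : CommutativeRing.Carrier R) where
  open CommutativeRing R hiding (zero)
  open ColumnDeterminant R
  open import Algebra.Properties.Semiring.Exp semiring
  open import Algebra.Properties.CommutativeSemiring.Exp commutativeSemiring using (^-distrib-*)
  open import Algebra.Solver.Ring.NaturalCoefficients.Default commutativeSemiring
    using (solve; _:=_; _:+_; _:*_; con)
  open import Relation.Binary.Reasoning.Setoid setoid

  -- E (suc h) i is the total weight of the paths with i steps that start at height h and never
  -- run below the axis; the index is shifted so that E 0 can stand for height -1.
  E : ℕ → Column
  E zero    i       = 0#
  E (suc h) zero    = 1#
  E (suc h) (suc i) = E (suc (suc h)) i + s * E (suc h) i + q * E h i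

  Δ : ℕ → Column
  Δ h i = E (suc h) i + (- 1#) * E h i

  Δ-suc : ∀ h i → Δ (suc h) (suc i) ≈ Δ (suc (suc h)) i + s * Δ (suc h) i + q * Δ h i
  Δ-suc h i = solve 7 (λ s q e a b c d →
    a :+ s :* b :+ q :* c :+ e :* (b :+ s :* c :+ q :* d) :=
    a :+ e :* b :+ s :* (b :+ e :* c) :+ q :* (c :+ e :* d))
    refl s q (- 1#) (E (suc (suc (suc h))) i) (E (suc (suc h)) i) (E (suc h) i) (E h i)

  -- A path with fewer than h steps starting at height h - 1 or h cannot run below the axis, so both
  -- terms of `Δ h i` sum over all step sequences.
  Δ-upper : ∀ {i h} → i ℕ.< h → Δ h i ≈ 0#
  Δ-upper {zero}  {suc h} _         = neg-cancel 1#
  Δ-upper {suc i} {suc h} (s≤s i<h) = begin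
    Δ (suc h) (suc i)                                  ≈⟨ Δ-suc h i ⟩
    Δ (suc (suc h)) i + s * Δ (suc h) i + q * Δ h i
      ≈⟨ +-cong (+-cong (Δ-upper (ℕₚ.m<n⇒m<1+n (ℕₚ.m<n⇒m<1+n i<h)))
                        (*-congˡ (Δ-upper (ℕₚ.m<n⇒m<1+n i<h))))
                (*-congˡ (Δ-upper i<h)) ⟩
    0# + s * 0# + q * 0#
      ≈⟨ solve 2 (λ s q → con 0 :+ s :* con 0 :+ q :* con 0 := con 0) refl s q ⟩
    0#                                                 ∎

  -- Among the step sequences of length h, only the one with h down-steps is lost when the start is
  -- lowered from h to h - 1; its weight is the difference.
  Δ-diagonal : ∀ h → Δ h h ≈ q ^ h
  Δ-diagonal zero    = trans (+-congˡ (zeroʳ _)) (+-identityʳ _)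
  Δ-diagonal (suc h) = begin
    Δ (suc h) (suc h)                                  ≈⟨ Δ-suc h h ⟩
    Δ (suc (suc h)) h + s * Δ (suc h) h + q * Δ h h
      ≈⟨ +-cong (+-cong (Δ-upper (ℕₚ.m<n⇒m<1+n (ℕₚ.n<1+n h))) (*-congˡ (Δ-upper (ℕₚ.n<1+n h))))
                (*-congˡ (Δ-diagonal h)) ⟩
    0# + s * 0# + q * q ^ h
      ≈⟨ solve 2 (λ s x → con 0 :+ s :* con 0 :+ x := x) refl s (q * q ^ h) ⟩
    q * q ^ h                                          ∎

  E-step : ∀ {i h} → i ℕ.< h → E (suc h) i ≈ E h i
  E-step {i} {h} i<h = begin
    x                        ≈⟨ sym (+-identityʳ x) ⟩
    x + 0#                   ≈⟨ +-congˡ (sym (neg-cancel y)) ⟩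
    x + (y + (- 1#) * y)     ≈⟨ solve 3 (λ x y e → x :+ (y :+ e :* y) := (x :+ e :* y) :+ y) refl x y (- 1#) ⟩
    Δ h i + y                ≈⟨ +-congʳ (Δ-upper i<h) ⟩
    0# + y                   ≈⟨ +-identityˡ y ⟩
    y                        ∎
    where
    x = E (suc h) i
    y = E h i

  E-stable : ∀ {i n h} → i ℕ.< n → n ℕ.≤ h → E h i ≈ E n i
  E-stable {i} {n} {h} i<n n≤h with ℕₚ.m≤n⇒∃[o]m+o≡n n≤h
  ... | o , ≡.refl = go o
    where
    go : ∀ o → E (n ℕ.+ o) i ≈ E n i
    go zero    = reflexive (≡.cong (λ h → E h i) (ℕₚ.+-identityʳ n))
    go (suc o) = trans (reflexive (≡.cong (λ h → E h i) (ℕₚ.+-suc n o)))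
      (trans (E-step (ℕₚ.<-≤-trans i<n (ℕₚ.m≤m+n n o))) (go o))

  expand-Δ : ∀ n r pre h m → r ℕ.< h → expand n r pre (segment Δ h m) ≈ 0#
  expand-Δ n r pre h zero    r<h = refl
  expand-Δ n r pre h (suc m) r<h = begin
    _ ≈⟨ +-cong (*-congʳ (Δ-upper r<h)) (*-congˡ (expand-Δ n r _ (suc h) m (ℕₚ.m<n⇒m<1+n r<h))) ⟩
    _ ≈⟨ solve 2 (λ x e → con 0 :* x :+ e :* con 0 := con 0) refl _ (- 1#) ⟩
    _ ∎

  colDet-Δ : ∀ n r → colDet n r (segment Δ r n) ≈ q ^ rangeSum r n
  colDet-Δ zero    r = refl
  colDet-Δ (suc n) r = begin
    _ ≈⟨ +-cong (*-cong (Δ-diagonal r) (colDet-Δ n (suc r)))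
                (*-congˡ (expand-Δ n r [ Δ r ] (suc r) n (ℕₚ.n<1+n r))) ⟩
    _ ≈⟨ trans (+-congˡ (zeroʳ _)) (+-identityʳ _) ⟩
    _ ≈⟨ sym (^-homo-* q r _) ⟩
    _ ∎

  -- Subtracting from each column its left neighbour gives the `Δ` columns, where `Δ 0` is `E 1`
  -- since `E 0` vanishes. Their matrix is lower triangular with diagonal 1, q, ..., q^(n-1).
  colDet-E : ∀ n → colDet n 0 (segment E 1 n) ≈ q ^ (n C 2)
  colDet-E n = begin
    D (segment E 1 n)           ≈⟨ D-≡ (segment-cong 1 0 n (λ t _ → ≡.cong E (ℕₚ.+-suc t 0))) ⟩
    D (segment (E ∘ suc) 0 n)   ≈⟨ sym (D-unitriangular (E ∘ suc) Δ congruent n) ⟩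
    D (segment Δ 0 n)           ≈⟨ colDet-Δ n 0 ⟩
    q ^ rangeSum 0 n            ≈⟨ ^-congʳ q (≡.trans (bC2+rangeSum≡[r+b]C2 0 n)
                                                 (≡.cong (_C 2) (ℕₚ.+-identityʳ n))) ⟩
    q ^ (n C 2)                 ∎
    where
    open ColumnOperations R n
    congruent : ∀ j → ModSpan (E ∘ suc) j (E (suc j)) (Δ j)
    congruent zero    = base (λ t → trans (+-congˡ (zeroʳ _)) (+-identityʳ _))
    congruent (suc j) = add (- 1#) j (ℕₚ.n<1+n j) (λ t → +-comm _ _) (base (λ t → refl))

  -- A basis of columns in blocks of k + 1, and the Hankel determinant.

  module Blocks (k : ℕ) where

    m : ℕ
    m = suc k

    -- With t = x + y + z + xy/z, the column E h corresponds to the polynomial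
    -- (zʰ - (xy/z)ʰ) / (z - xy/z) in t; Φ a b is the multiple of E m by a polynomial in the shift
    -- that is monic of degree b + a m.
    Φ : ℕ → ℕ → Column
    Φ a zero    = E (suc a ℕ.* m)
    Φ a (suc b) i = E (suc b ℕ.+ suc a ℕ.* m) i + q ^ suc b * E (suc a ℕ.* m ℕ.∸ suc b) i

    φ : ℕ → Column
    φ j = Φ (j / m) (j % m)

    φ≡Φ : ∀ a b → b ℕ.< m → φ (b ℕ.+ a ℕ.* m) ≡ Φ a b
    φ≡Φ a b b<m = ≡.cong₂ Φ
      (≡.trans (+-distrib-/-∣ʳ b (n∣m*n a)) (≡.cong₂ ℕ._+_ (m<n⇒m/n≡0 b<m) (m*n/n≡m a m)))
      (≡.trans ([m+kn]%n≡m%n b a m) (m<n⇒m%n≡m b<m))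

    -- With K = `suc a ℕ.* m`, this is the polynomial of `E K` times zᵇ + (q/z)ᵇ. Unlike `Φ` it
    -- follows one formula for all b from 0 to m, so that multiplication by z + q/z becomes a
    -- three-term recurrence.
    Ψ : ℕ → ℕ → Column
    Ψ a b i = E (b ℕ.+ suc a ℕ.* m) i + q ^ b * E (suc a ℕ.* m ℕ.∸ b) i

    -- The successor form lets the recurrence of `E` compute at this index.
    ∸-suc : ∀ a b → b ℕ.< m → suc a ℕ.* m ℕ.∸ b ≡ suc (suc a ℕ.* m ℕ.∸ suc b)
    ∸-suc a b b<m = ℕₚ.+-∸-assoc 1 {suc a ℕ.* m} {suc b} (ℕₚ.≤-trans b<m (ℕₚ.m≤m+n m (a ℕ.* m)))

    shift-Φ-zero : ∀ a t → Φ a 0 (suc t) ≈ s * Φ a 0 t + Ψ a 1 t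
    shift-Φ-zero a t = solve 5 (λ s q u v w → u :+ s :* v :+ q :* w := s :* v :+ (u :+ (q :* con 1) :* w))
      refl s q (E (suc (suc a ℕ.* m)) t) (E (suc a ℕ.* m) t) (E (suc a ℕ.* m ℕ.∸ 1) t)

    shift-Φ-suc : ∀ a b t → suc b ℕ.< m →
      Φ a (suc b) (suc t) ≈ q * Ψ a b t + (s * Φ a (suc b) t + Ψ a (suc (suc b)) t)
    shift-Φ-suc a b t b<m
      rewrite ∸-suc a b (ℕₚ.<⇒≤ b<m) | ∸-suc a (suc b) b<m
      = solve 9 (λ s q p e₂ e₁ e₀ f₂ f₁ f₀ →
          e₂ :+ s :* e₁ :+ q :* e₀ :+ (q :* p) :* (f₂ :+ s :* f₁ :+ q :* f₀) :=
          q :* (e₀ :+ p :* f₂) :+ (s :* (e₁ :+ (q :* p) :* f₁) :+ (e₂ :+ (q :* (q :* p)) :* f₀)))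
          refl s q (q ^ b) _ _ _ _ _ _

    module _ (n : ℕ) where
      open ColumnOperations R n

      -- Inside the block `Ψ a (suc b)` is the next column itself. At the end of the block it is the
      -- first column of the next block plus `q ^ m` times the first column of the preceding one, or
      -- plus a multiple of `E 0` = 0 if a = 0.
      φ-top : ∀ a b → b ℕ.< m →
        ModSpan φ (suc (b ℕ.+ a ℕ.* m)) (φ (suc (b ℕ.+ a ℕ.* m))) (Ψ a (suc b))
      φ-top a b b<m with ℕₚ.m≤n⇒m<n∨m≡n b<m
      ... | inj₁ 1+b<m rewrite φ≡Φ a (suc b) 1+b<m = base (λ t → refl)
      ... | inj₂ ≡.refl rewrite φ≡Φ (suc a) 0 (s≤s z≤n) = wrap a
        where
        E-zero : ∀ a t → E (suc a ℕ.* m ℕ.∸ m) t ≈ E (a ℕ.* m) t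
        E-zero a t = reflexive (≡.cong (λ h → E h t) (ℕₚ.m+n∸m≡n m (a ℕ.* m)))
        wrap : ∀ a → ModSpan φ (suc a ℕ.* m) (Φ (suc a) 0) (Ψ a m)
        wrap zero    = base (λ t → trans (+-congˡ (trans (*-congˡ (E-zero 0 t)) (zeroʳ _))) (+-identityʳ _))
        wrap (suc a) = add (q ^ m) (a ℕ.* m) 
          (ℕₚ.<-≤-trans (ℕₚ.m<n+m (a ℕ.* m) (s≤s z≤n)) (ℕₚ.m≤n+m (suc a ℕ.* m) m))
          (λ t → trans (+-comm _ _) (+-congʳ (*-congˡ (trans (E-zero (suc a) t)
            (reflexive (≡.cong (λ u → u t) (≡.sym (φ≡Φ a 0 (s≤s z≤n)))))))))
          (base (λ t → refl))

      -- The three-term recurrence writes the shifted column as `Ψ a (suc b)` plus multiples of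
      -- columns of index at most j; `φ-top` identifies the leading term.
      shift-φ : ∀ j → ModSpan φ (suc j) (φ (suc j)) (shift (φ j))
      shift-φ j = ≡.subst (λ j → ModSpan φ (suc j) (φ (suc j)) (shift (φ j)))
        (≡.sym (m≡m%n+[m/n]*n j m)) (at (j / m) (j % m) (m%n<n j m))
        where
        at : ∀ a b → b ℕ.< m → let j = b ℕ.+ a ℕ.* m in
          ModSpan φ (suc j) (φ (suc j)) (shift (φ j))
        at a zero b<m = add s (a ℕ.* m) (ℕₚ.n<1+n _) e (φ-top a 0 b<m)
          where
          e : ∀ t → φ (a ℕ.* m) (suc t) ≈ s * φ (a ℕ.* m) t + Ψ a 1 t
          e t rewrite φ≡Φ a 0 b<m = shift-Φ-zero a t
        at a (suc b) b<m = add-Ψ b (ℕₚ.<⇒≤ b<m) (shift-at b b<m)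
          (add s (suc b ℕ.+ a ℕ.* m) (ℕₚ.n<1+n _) (λ t → refl) (φ-top a (suc b) b<m))
          where
          shift-at : ∀ b → suc b ℕ.< m → ∀ t → let j = suc b ℕ.+ a ℕ.* m in
            φ j (suc t) ≈ q * Ψ a b t + (s * φ j t + Ψ a (suc (suc b)) t)
          shift-at b b<m t rewrite φ≡Φ a (suc b) b<m = shift-Φ-suc a b t b<m
          -- Ψ a 0 is twice Φ a 0.
          add-Ψ : ∀ b {u w w′} → b ℕ.< m → (∀ t → w t ≈ q * Ψ a b t + w′ t) →
            ModSpan φ (suc (suc b ℕ.+ a ℕ.* m)) u w′ → ModSpan φ (suc (suc b ℕ.+ a ℕ.* m)) u w
          add-Ψ zero {w = w} {w′} b<m e = add (q + q) (a ℕ.* m) (ℕₚ.m<n⇒m<1+n (ℕₚ.n<1+n _)) e′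
            where
            e′ : ∀ t → w t ≈ (q + q) * φ (a ℕ.* m) t + w′ t
            e′ t rewrite φ≡Φ a 0 b<m = trans (e t)
              (solve 3 (λ q z y → q :* (z :+ con 1 :* z) :+ y := (q :+ q) :* z :+ y) refl q _ _)
          add-Ψ (suc b) {w = w} {w′} b<m e =
            add q (suc b ℕ.+ a ℕ.* m) (ℕₚ.m<n⇒m<1+n (ℕₚ.n<1+n _)) e′
            where
            e′ : ∀ t → w t ≈ q * φ (suc b ℕ.+ a ℕ.* m) t + w′ t
            e′ t rewrite φ≡Φ a (suc b) b<m = e t

      -- On the n rows every `E h` beyond `E n` equals `E n`. If r = 0, then n = K and `E n` is no
      -- longer to the right of `E K`, whence the first alternative.
      E-tail : ∀ {K h} r → r ℕ.+ K ≡ n → K ℕ.< h →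
        ∃ λ h′ → E h ≋ E h′ × (h′ ≡ K ⊎ E h′ ∈ segment E (suc K) r)
      E-tail {K} {h} r r+K≡n K<h with h ℕ.≤? n
      ... | yes h≤n = h , ≋-refl , inj₂ (segment-∈ E (suc K) r h K<h
              (≡.subst (h ℕ.<_) (≡.sym (≡.trans (ℕₚ.+-suc r K) (≡.cong suc r+K≡n))) (s≤s h≤n)))
      ... | no  h≰n = n , (λ i i<n → E-stable i<n (ℕₚ.≰⇒≥ h≰n)) , position r r+K≡n
        where
        position : ∀ r → r ℕ.+ K ≡ n → n ≡ K ⊎ E n ∈ segment E (suc K) r
        position zero    K≡n    = inj₁ (≡.sym K≡n)
        position (suc r) ≡.refl = inj₂ (segment-∈ E (suc K) (suc r) n
          (s≤s (ℕₚ.m≤n+m K r)) (s≤s (ℕₚ.≤-reflexive (≡.sym (ℕₚ.+-suc r K)))))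

      -- In Φ a b the summand E (b + K) repeats another column, and E (K ∸ b) is then moved to
      -- the left over the b columns E (K ∸ b + 1), …, E K.
      D-block : ∀ a r xs → r ℕ.+ suc a ℕ.* m ≡ n →
        let zs = segment E (suc (suc a ℕ.* m)) r in
        D (xs ++ segment (Φ a) 0 m ++ zs) ≈
        ((- 1#) * q) ^ (m C 2) * D (xs ++ segment E (suc (a ℕ.* m)) m ++ zs)
      D-block a r xs r+K≡n = trans (go k 0 (ℕₚ.+-comm k 1))
        (*-congʳ (^-congʳ _ (≡.trans (bC2+rangeSum≡[r+b]C2 1 k) (≡.cong (_C 2) (ℕₚ.+-comm k 1)))))
        where
        K = suc a ℕ.* m
        zs = segment E (suc K) r
        -- Invariant: the block already starts with `E (K ∸ b)`, ..., `E K`, and r′ columns remain.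
        -- Handling `Φ a (suc b)` contributes (-q)^(b+1), and 1 + 2 + ... + k is `m C 2`.
        go : ∀ r′ b → r′ ℕ.+ suc b ≡ m →
          D (xs ++ segment E (K ℕ.∸ b) (suc b) ++ segment (Φ a) (suc b) r′ ++ zs) ≈
          ((- 1#) * q) ^ rangeSum (suc b) r′ * D (xs ++ segment E (suc (a ℕ.* m)) m ++ zs)
        go zero b ≡.refl = trans
          (D-≡ (≡.cong (λ h → xs ++ segment E h m ++ zs)
            (≡.trans (∸-suc a k (ℕₚ.n<1+n k)) (≡.cong suc (ℕₚ.m+n∸m≡n m (a ℕ.* m))))))
          (sym (*-identityˡ _))
        go (suc r′) b′ e with h′ , K+b≋h′ , h′∈ ← E-tail r r+K≡n (ℕₚ.m<n+m K {suc b′} (s≤s z≤n)) = begin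
          D (xs ++ S ++ Φ a b ∷ rest)
            ≈⟨ D-≡ (≡.sym (++-assoc xs S _)) ⟩
          D ((xs ++ S) ++ Φ a b ∷ rest)
            ≈⟨ D-absorb (xs ++ S) (q ^ b) (E (K ℕ.∸ b)) 1# (E h′)
                 (λ i i<n → trans (+-comm _ _)
                   (+-congˡ (trans (K+b≋h′ i i<n) (sym (*-identityˡ _)))))
                 (member h′∈) ⟩
          q ^ b * D ((xs ++ S) ++ E (K ℕ.∸ b) ∷ rest)
            ≈⟨ *-congˡ (D-≡ (++-assoc xs S _)) ⟩
          q ^ b * D (xs ++ S ++ E (K ℕ.∸ b) ∷ rest)
            ≈⟨ *-congˡ (D-move xs S (E (K ℕ.∸ b))) ⟩
          q ^ b * ((- 1#) ^ length S * D (xs ++ E (K ℕ.∸ b) ∷ S ++ rest))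
            ≈⟨ *-congˡ (*-cong (^-congʳ _ (length-segment E (K ℕ.∸ b′) b))
                 (D-≡ (≡.cong (λ h → xs ++ E (K ℕ.∸ b) ∷ segment E h b ++ rest) (∸-suc a b′ b′<m)))) ⟩
          q ^ b * ((- 1#) ^ b * D (xs ++ segment E (K ℕ.∸ b) (suc b) ++ rest))
            ≈⟨ *-congˡ (*-congˡ (go r′ b (≡.trans (ℕₚ.+-suc r′ b) e))) ⟩
          q ^ b * ((- 1#) ^ b * (((- 1#) * q) ^ t * X))
            ≈⟨ solve 4 (λ x y z w → x :* (y :* (z :* w)) := ((y :* x) :* z) :* w) refl _ _ _ _ ⟩
          ((- 1#) ^ b * q ^ b) * ((- 1#) * q) ^ t * X
            ≈⟨ *-congʳ (*-congʳ (sym (^-distrib-* (- 1#) q b))) ⟩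
          ((- 1#) * q) ^ b * ((- 1#) * q) ^ t * X
            ≈⟨ *-congʳ (sym (^-homo-* ((- 1#) * q) b t)) ⟩
          ((- 1#) * q) ^ (b ℕ.+ t) * X ∎
          where
          b = suc b′
          S = segment E (K ℕ.∸ b′) b
          rest = segment (Φ a) (suc b) r′ ++ zs
          t = rangeSum (suc b) r′
          X = D (xs ++ segment E (suc (a ℕ.* m)) m ++ zs)
          b′<m : b′ ℕ.< m
          b′<m = ℕₚ.≤-trans (ℕₚ.m≤n+m b (suc r′)) (ℕₚ.≤-reflexive e)
          member : ∀ {h} → h ≡ K ⊎ E h ∈ zs → E h ∈ xs ++ S ⊎ E h ∈ rest
          member (inj₁ ≡.refl) = inj₁ (∈-++⁺ʳ xs (segment-∈ E (K ℕ.∸ b′) b K (ℕₚ.m∸n≤m K b′)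
            (s≤s (ℕₚ.≤-reflexive (≡.sym
              (ℕₚ.m+[n∸m]≡n (ℕₚ.≤-trans (ℕₚ.<⇒≤ b′<m) (ℕₚ.m≤m+n m (a ℕ.* m)))))))))
          member (inj₂ h∈zs)   = inj₂ (∈-++⁺ʳ (segment (Φ a) (suc b) r′) h∈zs)

      -- A converted block joins the columns on its right, where it supplies the repetitions that
      -- clear the preceding block.
      D-blocks : ∀ a r → r ℕ.+ a ℕ.* m ≡ n →
        D (segment φ 0 (a ℕ.* m) ++ segment E (suc (a ℕ.* m)) r) ≈
        (((- 1#) * q) ^ (m C 2)) ^ a * D (segment E 1 n)
      D-blocks zero    r r+0≡n = trans
        (D-≡ (≡.cong (segment E 1) (≡.trans (≡.sym (ℕₚ.+-identityʳ r)) r+0≡n)))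
        (sym (*-identityˡ _))
      D-blocks (suc a) r r+K≡n = begin
        D (segment φ 0 K ++ zs)
          ≈⟨ D-≡ (≡.trans (≡.cong (_++ zs) split) (++-assoc (segment φ 0 o) _ _)) ⟩
        D (segment φ 0 o ++ segment (Φ a) 0 m ++ zs)
          ≈⟨ D-block a r (segment φ 0 o) r+K≡n ⟩
        g * D (segment φ 0 o ++ segment E (suc o) m ++ zs)
          ≈⟨ *-congˡ (D-≡ (≡.cong (segment φ 0 o ++_) (≡.trans
               (≡.cong (λ h → segment E (suc o) m ++ segment E h r) (≡.sym (ℕₚ.+-suc m o)))
               (segment-++ E (suc o) m r)))) ⟩
        g * D (segment φ 0 o ++ segment E (suc o) (m ℕ.+ r))
          ≈⟨ *-congˡ (D-blocks a (m ℕ.+ r) (≡.trans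
               (≡.trans (≡.cong (ℕ._+ o) (ℕₚ.+-comm m r)) (ℕₚ.+-assoc r m o)) r+K≡n)) ⟩
        g * (g ^ a * D (segment E 1 n))
          ≈⟨ sym (*-assoc _ _ _) ⟩
        g * g ^ a * D (segment E 1 n) ∎
        where
        o = a ℕ.* m
        K = suc a ℕ.* m
        zs = segment E (suc K) r
        g = ((- 1#) * q) ^ (m C 2)
        split : segment φ 0 K ≡ segment φ 0 o ++ segment (Φ a) 0 m
        split = ≡.trans (≡.cong (segment φ 0) (ℕₚ.+-comm m o)) (≡.trans
          (≡.sym (segment-++ φ 0 o m)) (≡.cong (segment φ 0 o ++_)
          (segment-cong (o ℕ.+ 0) 0 m (λ t t<m → ≡.trans
            (≡.cong (λ i → φ (t ℕ.+ i)) (ℕₚ.+-identityʳ o))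
            (≡.trans (φ≡Φ a t t<m) (≡.cong (Φ a) (≡.sym (ℕₚ.+-identityʳ t))))))))

      φ≋E : ∀ a → n ℕ.≤ suc a ℕ.* m → φ (a ℕ.* m) ≋ E n
      φ≋E a n≤K i i<n rewrite φ≡Φ a 0 (s≤s z≤n) = E-stable i<n n≤K

      hankel : ℕ → Column
      hankel j t = E m (t ℕ.+ j)

      D-hankel : D (segment hankel 0 n) ≈ D (segment φ 0 n)
      D-hankel = D-krylov φ hankel
        (λ t → reflexive (≡.trans (≡.cong₂ E (≡.sym (ℕₚ.+-identityʳ m)) (ℕₚ.+-identityʳ t))
          (≡.cong (λ u → u t) (≡.sym (φ≡Φ 0 0 (s≤s z≤n))))))
        (λ j t → reflexive (≡.cong (E m) (ℕₚ.+-suc t j)))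
        shift-φ n

      -- Each of the a full blocks contributes `((- 1#) * q) ^ (m C 2)`, and the columns E 1, ..., E
      -- n contribute `q ^ (n C 2)`.
      value : ℕ → Carrier
      value a = (- 1#) ^ (a ℕ.* (m C 2)) * q ^ (a ℕ.* (m C 2) ℕ.+ n C 2)

      D-blocks-value : ∀ a r → r ℕ.+ a ℕ.* m ≡ n →
        D (segment φ 0 (a ℕ.* m) ++ segment E (suc (a ℕ.* m)) r) ≈ value a
      D-blocks-value a r e = begin
        _ ≈⟨ D-blocks a r e ⟩
        (((- 1#) * q) ^ (m C 2)) ^ a * D (segment E 1 n)
          ≈⟨ *-cong (^-assocʳ _ (m C 2) a) (colDet-E n) ⟩
        ((- 1#) * q) ^ ((m C 2) ℕ.* a) * q ^ (n C 2)
          ≈⟨ *-congʳ (trans (^-congʳ _ (ℕₚ.*-comm (m C 2) a)) (^-distrib-* (- 1#) q T)) ⟩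
        (- 1#) ^ T * q ^ T * q ^ (n C 2)
          ≈⟨ trans (*-assoc _ _ _) (*-congˡ (sym (^-homo-* q T (n C 2)))) ⟩
        (- 1#) ^ T * q ^ (T ℕ.+ n C 2) ∎
        where T = a ℕ.* (m C 2)

      D-hankel-≡0 : ∀ a → n ≡ a ℕ.* m → D (segment hankel 0 n) ≈ value a
      D-hankel-≡0 a e = trans D-hankel (trans
        (D-≡ (≡.trans (≡.cong (segment φ 0) e) (≡.sym (++-identityʳ _))))
        (D-blocks-value a 0 (≡.sym e)))

      -- The incomplete last block is the single column `E (suc a ℕ.* m)`, which on the n rows
      -- equals `E n`; this is the tail of `D-blocks` with r = 1.
      D-hankel-≡1 : ∀ a → n ≡ suc (a ℕ.* m) → D (segment hankel 0 n) ≈ value a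
      D-hankel-≡1 a e = begin
        D (segment hankel 0 n)                     ≈⟨ D-hankel ⟩
        D (segment φ 0 n)                          ≈⟨ D-≡ split ⟩
        D (segment φ 0 o ++ [ φ o ])
          ≈⟨ D-cong (segment φ 0 o) (φ≋E a (ℕₚ.≤-trans (ℕₚ.≤-reflexive e) (s≤s (ℕₚ.m≤n+m o k)))) ⟩
        D (segment φ 0 o ++ [ E n ])               ≈⟨ D-≡ (≡.cong (λ h → segment φ 0 o ++ [ E h ]) e) ⟩
        D (segment φ 0 o ++ segment E (suc o) 1)   ≈⟨ D-blocks-value a 1 (≡.sym e) ⟩
        value a                                    ∎
        where
        o = a ℕ.* m
        split : segment φ 0 n ≡ segment φ 0 o ++ [ φ o ]
        split = ≡.trans (≡.cong (segment φ 0) (≡.trans e (ℕₚ.+-comm 1 o))) (≡.trans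
          (≡.sym (segment-++ φ 0 o 1)) (≡.cong (λ i → segment φ 0 o ++ [ φ i ]) (ℕₚ.+-identityʳ o)))

      D-hankel-vanishes : ∀ a r → suc (suc r) ℕ.≤ k → n ≡ suc (suc r) ℕ.+ a ℕ.* m →
        D (segment hankel 0 n) ≈ 0#
      D-hankel-vanishes a r 2+r≤k e = begin
        D (segment hankel 0 n)                     ≈⟨ D-hankel ⟩
        D (segment φ 0 n)                          ≈⟨ D-≡ split ⟩
        D (segment φ 0 o ++ φ o ∷ φ (suc o) ∷ rest)
          ≈⟨ D-cong (segment φ 0 o) (φ≋E a (ℕₚ.≤-trans n≤K-1 (ℕₚ.n≤1+n _))) ⟩
        D (segment φ 0 o ++ E n ∷ φ (suc o) ∷ rest)
          ≈⟨ D-≡ (≡.sym (++-assoc (segment φ 0 o) [ E n ] _)) ⟩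
        D ((segment φ 0 o ++ [ E n ]) ++ φ (suc o) ∷ rest)
          -- The second column is 1 + q times the first; written with a zero summand, it is absorbed
          -- and leaves the factor `0#`.
          ≈⟨ D-absorb (segment φ 0 o ++ [ E n ]) 0# (E n) (1# + q) (E n) second
               (inj₁ (∈-++⁺ʳ (segment φ 0 o) (here ≡.refl))) ⟩
        0# * _                                     ≈⟨ zeroˡ _ ⟩
        0#                                         ∎
        where
        o = a ℕ.* m
        rest = segment φ (suc (suc o)) r
        split : segment φ 0 n ≡ segment φ 0 o ++ φ o ∷ φ (suc o) ∷ rest
        split = ≡.trans (≡.cong (segment φ 0) (≡.trans e (ℕₚ.+-comm (suc (suc r)) o))) (≡.trans
          (≡.sym (segment-++ φ 0 o (suc (suc r))))
          (≡.cong (λ i → segment φ 0 o ++ segment φ i (suc (suc r))) (ℕₚ.+-identityʳ o)))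
        -- The last block has at most k columns, so with K = `suc a ℕ.* m` the columns of index K -
        -- 1, K and K + 1 all agree with `E n`.
        n≤K-1 : n ℕ.≤ k ℕ.+ o
        n≤K-1 = ℕₚ.≤-trans (ℕₚ.≤-reflexive e) (ℕₚ.+-monoˡ-≤ o 2+r≤k)
        second : φ (suc o) ≋ 0# ⊙ E n ⊕ (1# + q) ⊙ E n
        second i i<n rewrite φ≡Φ a 1 (s≤s (ℕₚ.≤-trans (s≤s z≤n) 2+r≤k)) = begin
          E (suc (m ℕ.+ o)) i + q * 1# * E (k ℕ.+ o) i
            ≈⟨ +-cong (E-stable i<n (ℕₚ.≤-trans n≤K-1 (ℕₚ.≤-trans (ℕₚ.n≤1+n _) (ℕₚ.n≤1+n _))))
                      (*-congˡ (E-stable i<n n≤K-1)) ⟩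
          E n i + q * 1# * E n i
            ≈⟨ solve 2 (λ q x → x :+ (q :* con 1) :* x := con 0 :* x :+ (con 1 :+ q) :* x) refl q _ ⟩
          0# * E n i + (1# + q) * E n i ∎

-- Weighted path sums satisfy the recurrence of `E`.

module PathRecurrence {c ℓ} (R : CommutativeRing c ℓ) (x y : CommutativeRing.Carrier R) where
  open CommutativeRing R hiding (zero)
  open ThreeStepPaths R x y
  open HeightColumns R (x + y) (x * y) using (E)
  open import Algebra.Properties.Semiring.Sum semiring
  open import Algebra.Solver.Ring.NaturalCoefficients.Default commutativeSemiring
    using (solve; _:=_; _:+_; _:*_; con)
  open import Relation.Binary.Reasoning.Setoid setoid

  totalWeight : ∀ {n} {P : Vec Step n → Set} → Decidable P → List (Vec Step n) → Carrier
  totalWeight P? ps = foldr _+_ 0# (map weight (filter P? ps))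

  totalWeight-++ : ∀ {n} {P : Vec Step n → Set} (P? : Decidable P) ps qs →
    totalWeight P? (ps ++ qs) ≈ totalWeight P? ps + totalWeight P? qs
  totalWeight-++ P? []       qs = sym (+-identityˡ _)
  totalWeight-++ P? (p ∷ ps) qs with P? p
  ... | yes _ = trans (+-congˡ (totalWeight-++ P? ps qs)) (sym (+-assoc _ _ _))
  ... | no  _ = totalWeight-++ P? ps qs

  totalWeight-map : ∀ {n} {P : Vec Step (suc n) → Set} {Q : Vec Step n → Set}
    (P? : Decidable P) (Q? : Decidable Q) st → (∀ p → P (st ∷ p) ⇔ Q p) → ∀ ps →
    totalWeight P? (map (st ∷_) ps) ≈ stepWeight st * totalWeight Q? ps
  totalWeight-map P? Q? st P⇔Q []       = sym (zeroʳ _)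
  totalWeight-map P? Q? st P⇔Q (p ∷ ps) with P? (st ∷ p) | Q? p
  ... | yes _  | yes _  = trans (+-congˡ (totalWeight-map P? Q? st P⇔Q ps)) (sym (distribˡ _ _ _))
  ... | no  _  | no  _  = totalWeight-map P? Q? st P⇔Q ps
  ... | yes Pp | no ¬Qp = contradiction (Equivalence.to (P⇔Q p) Pp) ¬Qp
  ... | no ¬Pp | yes Qp = contradiction (Equivalence.from (P⇔Q p) Qp) ¬Pp

  -- An integer starting height is allowed, since a down-step from the axis leads to height -1.
  CountedFrom : ∀ {n} → ℤ → ℕ → Vec Step n → Set
  CountedFrom h l p = endHeight h p ≡ + l × NeverBelow h p

  countedFrom? : ∀ {n} h l → Decidable (CountedFrom {n} h l)
  countedFrom? h l p = (endHeight h p ℤ.≟ + l) ×-dec All.all? (0ℤ ℤ.≤?_) (heights h p)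

  𝒬 : ℕ → ℤ → ℕ → Carrier
  𝒬 n h l = totalWeight (countedFrom? h l) (paths n)

  𝒬-step : ∀ n k l st →
    totalWeight (countedFrom? (+ k) l) (map (st ∷_) (paths n)) ≈
    stepWeight st * 𝒬 n (+ k ℤ.+ rise st) l
  𝒬-step n k l st = totalWeight-map (countedFrom? (+ k) l) (countedFrom? (+ k ℤ.+ rise st) l) st
    -- The starting height is non-negative, so the first step adds no condition to those on the rest
    -- of the path.
    (λ p → mk⇔ (λ { (e , _ ∷ nb) → e , nb }) (λ { (e , nb) → e , ℤ.+≤+ z≤n ∷ nb })) (paths n)

  𝒬-suc : ∀ n k l → 𝒬 (suc n) (+ k) l ≈
    𝒬 n (+ suc k) l + (x + y) * 𝒬 n (+ k) l + (x * y) * 𝒬 n (+ k ℤ.+ -1ℤ) l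
  𝒬-suc n k l = begin
    _ ≈⟨ totalWeight-++ P? (map (up ∷_) ps) _ ⟩
    _ ≈⟨ +-cong (𝒬-step n k l up) (trans (totalWeight-++ P? (map (level ∷_) ps) _)
           (+-cong (𝒬-step n k l level) (trans (totalWeight-++ P? (map (down ∷_) ps) [])
             (+-congʳ (𝒬-step n k l down))))) ⟩
    _ ≈⟨ solve 5 (λ s q u v w → con 1 :* u :+ (s :* v :+ (q :* w :+ con 0)) := u :+ s :* v :+ q :* w)
           refl (x + y) (x * y) _ _ _ ⟩
    _ ≡⟨ ≡.cong₂ (λ h h′ → 𝒬 n (+ h) l + (x + y) * 𝒬 n (+ h′) l + (x * y) * 𝒬 n (+ k ℤ.+ -1ℤ) l)
           (ℕₚ.+-comm k 1) (ℕₚ.+-identityʳ k) ⟩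
    _ ∎
    where
    P? = countedFrom? {suc n} (+ k) l
    ps = paths n

  𝒬-below : ∀ n l → 𝒬 n -1ℤ l ≡ 0#
  𝒬-below n l = ≡.cong (λ ps → foldr _+_ 0# (map weight ps))
    (filter-none (countedFrom? -1ℤ l) (All.universal below (paths n)))
    where
    below : ∀ {n} (p : Vec Step n) → ¬ CountedFrom -1ℤ l p
    below []      (_ , () ∷ _)
    below (_ ∷ _) (_ , () ∷ _)

  𝒬-zero-≡ : ∀ k → 𝒬 0 (+ k) k ≈ 1#
  𝒬-zero-≡ k = trans
    (reflexive (≡.cong (λ ps → foldr _+_ 0# (map weight ps))
      (filter-accept (countedFrom? {0} (+ k) k) {[]} {[]} (≡.refl , ℤ.+≤+ z≤n ∷ []))))
    (+-identityʳ _)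

  𝒬-zero-≢ : ∀ k l → l ≢ k → 𝒬 0 (+ k) l ≈ 0#
  𝒬-zero-≢ k l l≢k = reflexive (≡.cong (λ ps → foldr _+_ 0# (map weight ps))
    (filter-reject (countedFrom? {0} (+ k) l) {[]} {[]} (λ { (≡.refl , _) → l≢k ≡.refl })))

  sum-indicator : ∀ N k (f : ℕ → Carrier) → f k ≈ 1# → (∀ l → l ≢ k → f l ≈ 0#) → k ℕ.< N →
    sum {N} (λ l → f (toℕ l)) ≈ 1#
  sum-indicator (suc N) zero    f fk fl _ = trans
    (+-cong fk (trans (sum-cong-≋ {N} (λ l → fl (suc (toℕ l)) (λ ()))) (sum-replicate-zero N)))
    (+-identityʳ _)
  sum-indicator (suc N) (suc k) f fk fl (s≤s k<N) = trans
    (+-cong (fl 0 (λ ()))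
      (sum-indicator N k (f ∘ suc) fk (λ l l≢k → fl (suc l) (l≢k ∘ ℕₚ.suc-injective)) k<N))
    (+-identityˡ _)

  -- The bound N stays arbitrary above k + n, because the recurrence leads to the starting heights k
  -- + 1, k and k - 1, all summed over the same range of l.
  sum-𝒬 : ∀ N n k → k ℕ.+ n ℕ.< N → sum {N} (λ l → 𝒬 n (+ k) (toℕ l)) ≈ E (suc k) n
  sum-𝒬 N zero    k k<N = sum-indicator N k (𝒬 0 (+ k)) (𝒬-zero-≡ k) (𝒬-zero-≢ k)
    (≡.subst (ℕ._< N) (ℕₚ.+-identityʳ k) k<N)
  sum-𝒬 N (suc n) k k+n<N = begin
    sum {N} (λ l → 𝒬 (suc n) (+ k) (toℕ l))
      ≈⟨ sum-cong-≋ {N} (λ l → 𝒬-suc n k (toℕ l)) ⟩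
    sum {N} (λ l → u l + (x + y) * v l + (x * y) * w l)
      ≈⟨ trans (∑-distrib-+ {N} _ _) (+-congʳ (∑-distrib-+ {N} _ _)) ⟩
    sum u + sum {N} (λ l → (x + y) * v l) + sum {N} (λ l → (x * y) * w l)
      ≈⟨ sym (+-cong (+-congˡ (*-distribˡ-sum {N} (x + y) v)) (*-distribˡ-sum {N} (x * y) w)) ⟩
    sum u + (x + y) * sum v + (x * y) * sum w
      ≈⟨ +-cong (+-cong (sum-𝒬 N n (suc k) 1+k+n<N)
                        (*-congˡ (sum-𝒬 N n k (ℕₚ.<⇒≤ 1+k+n<N))))
                (*-congˡ (sum-w k 1+k+n<N)) ⟩
    E (suc (suc k)) n + (x + y) * E (suc k) n + (x * y) * E k n ∎
    where
    u v w : Fin N → Carrier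
    u l = 𝒬 n (+ suc k) (toℕ l)
    v l = 𝒬 n (+ k) (toℕ l)
    w l = 𝒬 n (+ k ℤ.+ -1ℤ) (toℕ l)
    1+k+n<N : suc (k ℕ.+ n) ℕ.< N
    1+k+n<N = ≡.subst (ℕ._< N) (ℕₚ.+-suc k n) k+n<N
    sum-w : ∀ k → suc (k ℕ.+ n) ℕ.< N → sum {N} (λ l → 𝒬 n (+ k ℤ.+ -1ℤ) (toℕ l)) ≈ E k n
    sum-w zero    _ = trans (sum-cong-≋ {N} (λ l → reflexive (𝒬-below n (toℕ l)))) (sum-replicate-zero N)
    sum-w (suc k) b = sum-𝒬 N n k (ℕₚ.<-trans (ℕₚ.m<n+m (k ℕ.+ n) {2} (s≤s z≤n)) b)

  Σ𝒫⁺≈E : ∀ n k → Σ𝒫⁺ n k ≈ E (suc k) n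
  Σ𝒫⁺≈E n k = sum-𝒬 (suc (k ℕ.+ n)) n k (ℕₚ.n<1+n _)

-- Arithmetic of the exponents.

2*nC2+n≡n*n : ∀ n → 2 ℕ.* (n C 2) ℕ.+ n ≡ n ℕ.* n
2*nC2+n≡n*n zero    = ≡.refl
2*nC2+n≡n*n (suc n) = begin
  2 ℕ.* (suc n C 2) ℕ.+ suc n         ≡⟨ ≡.cong (λ t → 2 ℕ.* t ℕ.+ suc n) ([1+n]C2≡n+nC2 n) ⟩
  2 ℕ.* (n ℕ.+ n C 2) ℕ.+ suc n       ≡⟨ expand n (n C 2) ⟩
  (2 ℕ.* (n C 2) ℕ.+ n) ℕ.+ suc (n ℕ.+ n)   ≡⟨ ≡.cong (ℕ._+ suc (n ℕ.+ n)) (2*nC2+n≡n*n n) ⟩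
  n ℕ.* n ℕ.+ suc (n ℕ.+ n)           ≡⟨ square n ⟩
  suc n ℕ.* suc n                     ∎
  where
  open ≡.≡-Reasoning
  expand : ∀ n t → 2 ℕ.* (n ℕ.+ t) ℕ.+ suc n ≡ (2 ℕ.* t ℕ.+ n) ℕ.+ suc (n ℕ.+ n)
  expand = solve-∀
  square : ∀ n → n ℕ.* n ℕ.+ suc (n ℕ.+ n) ≡ suc n ℕ.* suc n
  square = solve-∀

-- After doubling, `2*nC2+n≡n*n` removes the binomials, and both sides become m² (a² + a).
exponent : ∀ m a → a ℕ.* (m C 2) ℕ.+ suc (m ℕ.* a) C 2 ≡ m ℕ.^ 2 ℕ.* (suc a C 2)
exponent m a = ℕₚ.*-cancelˡ-≡ _ _ 2 (begin
  2 ℕ.* (a ℕ.* (m C 2) ℕ.+ suc N C 2)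
    ≡⟨ ≡.cong (λ t → 2 ℕ.* (a ℕ.* (m C 2) ℕ.+ t)) ([1+n]C2≡n+nC2 N) ⟩
  2 ℕ.* (a ℕ.* (m C 2) ℕ.+ (m ℕ.* a ℕ.+ N C 2))
    ≡⟨ regroup m a (m C 2) (N C 2) ⟩
  a ℕ.* (2 ℕ.* (m C 2) ℕ.+ m) ℕ.+ (2 ℕ.* (N C 2) ℕ.+ N)
    ≡⟨ ≡.cong₂ (λ u v → a ℕ.* u ℕ.+ v) (2*nC2+n≡n*n m) (2*nC2+n≡n*n N) ⟩
  a ℕ.* (m ℕ.* m) ℕ.+ (m ℕ.* a) ℕ.* (m ℕ.* a)
    ≡⟨ factor m a ⟩
  m ℕ.^ 2 ℕ.* (a ℕ.* a ℕ.+ a)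
    ≡⟨ ≡.cong (λ t → m ℕ.^ 2 ℕ.* (t ℕ.+ a)) (≡.sym (2*nC2+n≡n*n a)) ⟩
  m ℕ.^ 2 ℕ.* (2 ℕ.* (a C 2) ℕ.+ a ℕ.+ a)
    ≡⟨ double m a (a C 2) ⟩
  2 ℕ.* (m ℕ.^ 2 ℕ.* (a ℕ.+ a C 2))
    ≡⟨ ≡.cong (λ t → 2 ℕ.* (m ℕ.^ 2 ℕ.* t)) (≡.sym ([1+n]C2≡n+nC2 a)) ⟩
  2 ℕ.* (m ℕ.^ 2 ℕ.* (suc a C 2)) ∎)
  where
  open ≡.≡-Reasoning
  N = m ℕ.* a
  regroup : ∀ m a s t → 2 ℕ.* (a ℕ.* s ℕ.+ (m ℕ.* a ℕ.+ t)) ≡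
    a ℕ.* (2 ℕ.* s ℕ.+ m) ℕ.+ (2 ℕ.* t ℕ.+ m ℕ.* a)
  regroup = solve-∀
  factor : ∀ m a → a ℕ.* (m ℕ.* m) ℕ.+ (m ℕ.* a) ℕ.* (m ℕ.* a) ≡ m ℕ.* (m ℕ.* 1) ℕ.* (a ℕ.* a ℕ.+ a)
  factor = solve-∀
  double : ∀ m a t → m ℕ.* (m ℕ.* 1) ℕ.* (2 ℕ.* t ℕ.+ a ℕ.+ a) ≡ 2 ℕ.* (m ℕ.* (m ℕ.* 1) ℕ.* (a ℕ.+ t))
  double = solve-∀

-- Evaluation of the determinant by the residue of n modulo k + 1.

theorem3 : ∀ {c ℓ} (R : CommutativeRing c ℓ) (x y : CommutativeRing.Carrier R) →
    let open CommutativeRing R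
        open Algebra.Properties.Semiring.Exp semiring using (_^_)
        open Determinant R
        open ThreeStepPaths R x y
    in
    ∀ (n k : ℕ) → 1 ℕ.≤ n →
    let D = det n (λ i j → Σ𝒫⁺ (toℕ i ℕ.+ toℕ j) k)
    in
    (∀ n₁ → n ≡ suc k ℕ.* n₁ →
       D ≈ (- 1#) ^ (n₁ ℕ.* (suc k C 2)) * (x * y) ^ ((suc k ℕ.^ 2 ℕ.* (suc n₁ C 2)) ℕ.∸ n))
    × (k ≢ 0 → ∀ n₁ → n ≡ suc k ℕ.* n₁ ℕ.+ 1 →
       D ≈ (- 1#) ^ (n₁ ℕ.* (suc k C 2)) * (x * y) ^ (suc k ℕ.^ 2 ℕ.* (suc n₁ C 2)))
    × (n % suc k ≢ 0 → n % suc k ≢ 1 % suc k → D ≈ 0#)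
theorem3 R x y n k _ = case₀ , case₁ , case₂
  where
  open CommutativeRing R hiding (zero)
  open import Algebra.Properties.Semiring.Exp semiring using (_^_; ^-congʳ)
  open Determinant R using (det)
  open ThreeStepPaths R x y using (Σ𝒫⁺)
  open PathRecurrence R x y using (Σ𝒫⁺≈E)
  open ColumnDeterminant R using (colDet; det≈colDet)
  open HeightColumns R (x + y) (x * y)
  open Blocks k

  hankelDet : det n (λ i j → Σ𝒫⁺ (toℕ i ℕ.+ toℕ j) k) ≈ colDet n 0 (segment (hankel n) 0 n)
  hankelDet = trans
    (det≈colDet n 0 (λ j → hankel n (toℕ j ℕ.+ 0)) (λ i j → trans (Σ𝒫⁺≈E (toℕ i ℕ.+ toℕ j) k)
      (reflexive (≡.cong (λ t → E m (toℕ i ℕ.+ t)) (≡.sym (ℕₚ.+-identityʳ (toℕ j)))))))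
    (reflexive (≡.cong (colDet n 0) (tabulate-segment (hankel n) 0 n)))

  case₀ : ∀ n₁ → n ≡ m ℕ.* n₁ →
    _ ≈ (- 1#) ^ (n₁ ℕ.* (m C 2)) * (x * y) ^ (m ℕ.^ 2 ℕ.* (suc n₁ C 2) ℕ.∸ n)
  case₀ n₁ e = trans hankelDet (trans (D-hankel-≡0 n n₁ (≡.trans e (ℕₚ.*-comm m n₁)))
    (*-congˡ (^-congʳ (x * y) (≡.sym degree))))
    where
    open ≡.≡-Reasoning
    T = n₁ ℕ.* (m C 2)
    -- Since `suc n C 2` is n plus `n C 2`, the truncated subtraction of n is exact.
    degree : m ℕ.^ 2 ℕ.* (suc n₁ C 2) ℕ.∸ n ≡ T ℕ.+ n C 2
    degree = begin
      m ℕ.^ 2 ℕ.* (suc n₁ C 2) ℕ.∸ n        ≡⟨ ≡.cong (ℕ._∸ n) (≡.sym (exponent m n₁)) ⟩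
      T ℕ.+ suc (m ℕ.* n₁) C 2 ℕ.∸ n        ≡⟨ ≡.cong (λ N → T ℕ.+ suc N C 2 ℕ.∸ n) (≡.sym e) ⟩
      T ℕ.+ suc n C 2 ℕ.∸ n                 ≡⟨ ≡.cong (λ t → T ℕ.+ t ℕ.∸ n)
                                                 (≡.trans ([1+n]C2≡n+nC2 n) (ℕₚ.+-comm n _)) ⟩
      T ℕ.+ (n C 2 ℕ.+ n) ℕ.∸ n             ≡⟨ ≡.cong (ℕ._∸ n) (≡.sym (ℕₚ.+-assoc T (n C 2) n)) ⟩
      T ℕ.+ n C 2 ℕ.+ n ℕ.∸ n               ≡⟨ ℕₚ.m+n∸n≡m (T ℕ.+ n C 2) n ⟩
      T ℕ.+ n C 2                           ∎

  case₁ : k ≢ 0 → ∀ n₁ → n ≡ m ℕ.* n₁ ℕ.+ 1 →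
    _ ≈ (- 1#) ^ (n₁ ℕ.* (m C 2)) * (x * y) ^ (m ℕ.^ 2 ℕ.* (suc n₁ C 2))
  case₁ _ n₁ e = trans hankelDet (trans
    (D-hankel-≡1 n n₁ (≡.trans e′ (≡.cong suc (ℕₚ.*-comm m n₁))))
    (*-congˡ (^-congʳ (x * y) (≡.trans (≡.cong (λ N → n₁ ℕ.* (m C 2) ℕ.+ N C 2) e′) (exponent m n₁)))))
    where
    e′ : n ≡ suc (m ℕ.* n₁)
    e′ = ≡.trans e (ℕₚ.+-comm (m ℕ.* n₁) 1)

  case₂ : n % m ≢ 0 → n % m ≢ 1 % m → _ ≈ 0#
  case₂ ≢0 ≢1 = trans hankelDet (split (n % m) ≢0 ≢1 (m%n<n n m) (m≡m%n+[m/n]*n n m))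
    where
    split : ∀ r → r ≢ 0 → r ≢ 1 % m → r ℕ.< m → n ≡ r ℕ.+ n / m ℕ.* m →
      colDet n 0 (segment (hankel n) 0 n) ≈ 0#
    split 0             r≢0 _   _   _ = contradiction ≡.refl r≢0
    -- A remainder 1 forces m > 1, so that `1 % m` is 1.
    split 1             _   r≢1 1<m _ = contradiction (≡.sym (m<n⇒m%n≡m 1<m)) r≢1
    split (suc (suc r)) _   _   r<m e = D-hankel-vanishes n (n / m) r (ℕₚ.≤-pred r<m) e
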